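{- Let $p\in\{2,3\}$ and let $A=(a_1,a_2,a_3)$ with $\gcd(a_1,a_2,a_3)=1$, where $a_i=pk_i+t_i$ with $k_i\in\mathbb{Z}^{+}$ and $t_i$ an integer with $0\leq t_i\leq p-1$ for $1\leq i\leq 3$. Then the quotient $\frac{\langle A\rangle}{p}$ is given as follows. For $p=2$: - if $(t_1,t_2,t_3)=(0,0,1)$, then $\frac{\langle A\rangle}{2}=\left\langle \frac{a_1}{2},\frac{a_2}{2},a_3\right\rangle$; - if $(t_1,t_2,t_3)=(0,1,1)$, then $\frac{\langle A\rangle}{2}=\left\langle \frac{a_1}{2},a_2,a_3,\frac{a_2+a_3}{2}\right\rangle$; - if $(t_1,t_2,t_3)=(1,1,1)$, then $\frac{\langle A\rangle}{2}=\left\langle a_1,a_2,a_3,\frac{a_1+a_2}{2},\frac{a_1+a_3}{2},\frac{a_2+a_3}{2}\right\rangle$. For $p=3$: - if $(t_1,t_2,t_3)=(0,0,1)$ or $(0,0,2)$, then $\frac{\langle A\rangle}{3}=\left\langle \frac{a_1}{3},\frac{a_2}{3},a_3\right\rangle$; - if $(t_1,t_2,t_3)=(0,1,1)$ or $(0,2,2)$, then $\frac{\langle A\rangle}{3}=\left\langle \frac{a_1}{3},a_2,a_3,\frac{2a_2+a_3}{3},\frac{a_2+2a_3}{3}\right\rangle$; - if $(t_1,t_2,t_3)=(0,1,2)$, then $\frac{\langle A\rangle}{3}=\left\langle \frac{a_1}{3},a_2,a_3,\frac{a_2+a_3}{3}\right\rangle$; - if $(t_1,t_2,t_3)=(1,1,1)$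 or $(2,2,2)$, then $\frac{\langle A\rangle}{3}=\left\langle a_1,a_2,a_3,\frac{2a_1+a_2}{3},\frac{2a_1+a_3}{3},\frac{2a_2+a_1}{3},\frac{2a_2+a_3}{3},\frac{2a_3+a_1}{3},\frac{2a_3+a_2}{3},\frac{a_1+a_2+a_3}{3}\right\rangle$; - if $(t_1,t_2,t_3)=(1,1,2)$, then $\frac{\langle A\rangle}{3}=\left\langle a_1,a_2,a_3,\frac{a_1+a_3}{3},\frac{a_2+a_3}{3},\frac{2a_1+a_2}{3},\frac{2a_2+a_1}{3}\right\rangle$; - if $(t_1,t_2,t_3)=(1,2,2)$, then $\frac{\langle A\rangle}{3}=\left\langle a_1,a_2,a_3,\frac{a_1+a_2}{3},\frac{a_1+a_3}{3},\frac{2a_2+a_3}{3},\frac{2a_3+a_2}{3}\right\rangle$.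
   Context: $\mathbb{N}$ denotes the non-negative integers and $\mathbb{Z}^{+}$ the positive integers. For positive integers $b_1,\ldots,b_m$, $\langle b_1,\ldots,b_m\rangle=\{x_1b_1+\cdots+x_mb_m\mid x_i\in\mathbb{N}\}$ is the submonoid of $(\mathbb{N},+)$ they generate, and for $A=(a_1,a_2,a_3)$ we write $\langle A\rangle=\langle a_1,a_2,a_3\rangle$. The quotient of $\langle A\rangle$ by $p\in\mathbb{Z}^+$ is $\frac{\langle A\rangle}{p}=\{m\in\mathbb{N}\mid pm\in\langle A\rangle\}$. -}

module Defs where

open import Data.Nat.Base using (ℕ; _*_; NonZero)
open import Data.Product.Base using (∃-syntax)
open import Data.Vec.Base using (Vec; sum; zipWith)
open import Level using (0ℓ)
open import Relation.Binary.PropositionalEquality.Core using (_≡_)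
open import Relation.Unary using (Pred; _∈_)

-- Submonoid of (ℕ , +) generated by b₁ , … , bₘ.
⟨_⟩ : ∀ {m} → Vec ℕ m → Pred ℕ 0ℓ
⟨_⟩ {m} b n = ∃[ x ] n ≡ sum (zipWith {n = m} _*_ x b)

infixl 7 _÷_

-- Quotient of a set of naturals by a positive integer: { m ∣ p m ∈ S }.
_÷_ : Pred ℕ 0ℓ → (p : ℕ) → .{{NonZero p}} → Pred ℕ 0ℓ
(S ÷ p) m = p * m ∈ S

{-# OPTIONS --safe #-}

-- Write x = p q + r with 0 ≤ rᵢ < p.  As a = p k + t, p divides x · a exactly
-- when it divides r · t.  So x · a / p is q · a + r · a / p, and it lies in the
-- claimed monoid as soon as every aᵢ does and each of the finitely many residue
-- vectors r with p ∣ r · t is a sum of coefficient vectors of p times a generator.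
-- The latter does not involve k and is decided by computation, case by case.
module Submission where

open import Defs
open import Data.Bool.Base using (T)
open import Data.Bool.Properties using (T?)
open import Data.Fin.Base using (Fin; zero; suc; toℕ)
import Data.Fin.Properties as Fin
open import Data.Maybe using (Maybe; just; nothing; is-just; to-witness-T; _<∣>_)
import Data.Maybe as Maybe
open import Data.Nat.Base using (ℕ; zero; suc; _+_; _*_; _∸_; _≤_; _/_; NonZero)
open import Data.Nat.Divisibility using (_∣_; _∣?_; ∣m+n∣m⇒∣n; ∣m∣n⇒∣m+n; m∣m*n)
open import Data.Nat.DivMod using (_divMod_; result; m*[n/m]≡n)
open import Data.Nat.GCD using (gcd)
open import Data.Nat.Properties
open import Data.Nat.Tactic.RingSolver using (solve-∀)
open import Data.Product.Base using (∃-syntax; _×_; _,_; proj₁; proj₂)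
open import Data.Sum.Base using (_⊎_; inj₁; inj₂)
open import Data.Vec.Base using (Vec; _∷_; []; lookup; map; replicate; sum; zipWith)
open import Data.Vec.Properties using (≡-dec)
open import Data.Vec.Relation.Unary.All as All using (All; _∷_; []; all?)
open import Data.Vec.Relation.Unary.All.Properties using (lookup⁻; map⁺)
open import Level using (0ℓ)
open import Relation.Binary.PropositionalEquality
open import Relation.Nullary.Decidable
  using (Dec; yes; no; True; toWitness; map′; _×-dec_; _→-dec_)
open import Relation.Unary using (Pred; Decidable; _∈_; _⊆_; _≐_)

private variable
  m n : ℕ

-- Dot products of vectors of naturals

infixl 7 _·_
infixl 6 _⊕_

_·_ : Vec ℕ n → Vec ℕ n → ℕ
x · a = sum (zipWith _*_ x a)

_⊕_ : Vec ℕ n → Vec ℕ n → Vec ℕ n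
_⊕_ = zipWith _+_

unit : Fin n → Vec ℕ n
unit zero    = 1 ∷ replicate _ 0
unit (suc i) = 0 ∷ unit i

·-zeroˡ : (a : Vec ℕ n) → replicate n 0 · a ≡ 0
·-zeroˡ []      = refl
·-zeroˡ (_ ∷ a) = ·-zeroˡ a

·-distribʳ-⊕ : (a x y : Vec ℕ n) → (x ⊕ y) · a ≡ x · a + y · a
·-distribʳ-⊕ []      []      []      = refl
·-distribʳ-⊕ (a ∷ as) (x ∷ xs) (y ∷ ys) =
  trans (cong ((x + y) * a +_) (·-distribʳ-⊕ as xs ys))
        (rearrange a x y (xs · as) (ys · as))
  where
  rearrange : ∀ a x y u v → (x + y) * a + (u + v) ≡ x * a + u + (y * a + v)
  rearrange = solve-∀

·-assoc-map : ∀ s (x a : Vec ℕ n) → map (s *_) x · a ≡ s * (x · a)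
·-assoc-map s []       []       = sym (*-zeroʳ s)
·-assoc-map s (x ∷ xs) (a ∷ as) =
  trans (cong₂ _+_ (*-assoc s x a) (·-assoc-map s xs as))
        (sym (*-distribˡ-+ s (x * a) (xs · as)))

·-comm : (x a : Vec ℕ n) → x · a ≡ a · x
·-comm []       []       = refl
·-comm (x ∷ xs) (a ∷ as) = cong₂ _+_ (*-comm x a) (·-comm xs as)

·-unit : ∀ i (a : Vec ℕ n) → unit i · a ≡ lookup a i
·-unit zero    (a ∷ as) =
  trans (cong₂ _+_ (*-identityˡ a) (·-zeroˡ as)) (+-identityʳ a)
·-unit (suc i) (_ ∷ as) = ·-unit i as

·-scaled-unit : ∀ s i (a : Vec ℕ n) → map (s *_) (unit i) · a ≡ s * lookup a i
·-scaled-unit s i a = trans (·-assoc-map s (unit i) a) (cong (s *_) (·-unit i a))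

-- Separates the multiple of `p` from the residue part, so that divisibility of `x · a` by `p`
-- becomes a question about `t` alone.
·-affine : ∀ p (x k t : Vec ℕ n) →
           x · (map (p *_) k ⊕ t) ≡ p * (x · k) + x · t
·-affine p x k t = begin
  x · (map (p *_) k ⊕ t)       ≡⟨ ·-comm x _ ⟩
  (map (p *_) k ⊕ t) · x       ≡⟨ ·-distribʳ-⊕ x (map (p *_) k) t ⟩
  map (p *_) k · x + t · x     ≡⟨ cong₂ _+_ (·-assoc-map p k x) (·-comm t x) ⟩
  p * (k · x) + x · t          ≡⟨ cong (λ u → p * u + x · t) (·-comm k x) ⟩
  p * (x · k) + x · t          ∎
  where open ≡-Reasoning

-- The remainders are kept in `Fin p`, so that only finitely many residue vectors have to be
-- inspected.
∃-divMod : ∀ p .{{_ : NonZero p}} (x : Vec ℕ n) →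
           ∃[ q ] ∃[ r ] x ≡ map (p *_) q ⊕ map (toℕ {p}) r
∃-divMod p []       = [] , [] , refl
∃-divMod p (x ∷ xs) with x divMod p | ∃-divMod p xs
... | result q r eq | qs , rs , eqs =
  q ∷ qs , r ∷ rs ,
  cong₂ _∷_ (trans eq (trans (+-comm (toℕ r) _) (cong (_+ toℕ r) (*-comm q p)))) eqs

-- Generated submonoids and closure

0∈⟨⟩ : (b : Vec ℕ m) → 0 ∈ ⟨ b ⟩
0∈⟨⟩ b = replicate _ 0 , sym (·-zeroˡ b)

⟨⟩-closed-+ : (b : Vec ℕ m) {u v : ℕ} → u ∈ ⟨ b ⟩ → v ∈ ⟨ b ⟩ → u + v ∈ ⟨ b ⟩
⟨⟩-closed-+ b (x , refl) (y , refl) = x ⊕ y , sym (·-distribʳ-⊕ b x y)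

module _ {P : Pred ℕ 0ℓ} (P-0 : P 0) (P-+ : ∀ {u v} → P u → P v → P (u + v)) where

  closed-* : ∀ s {u} → P u → P (s * u)
  closed-* zero    Pu = P-0
  closed-* (suc s) Pu = P-+ Pu (closed-* s Pu)

  ⟨⟩-least : {b : Vec ℕ m} → All P b → ⟨ b ⟩ ⊆ P
  ⟨⟩-least []        ([]     , refl) = P-0
  ⟨⟩-least (Pb ∷ Pbs) (x ∷ xs , refl) =
    P-+ (closed-* x Pb) (⟨⟩-least Pbs (xs , refl))

÷-closed-+ : ∀ p .{{_ : NonZero p}} (a : Vec ℕ n) {u v : ℕ} →
             u ∈ ⟨ a ⟩ ÷ p → v ∈ ⟨ a ⟩ ÷ p → u + v ∈ ⟨ a ⟩ ÷ p
÷-closed-+ p a {u} {v} u∈ v∈ =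
  subst (_∈ ⟨ a ⟩) (sym (*-distribˡ-+ p u v)) (⟨⟩-closed-+ a u∈ v∈)

-- Searching for decompositions of coefficient vectors

-- Sums of members of the list, with repetition: `use` keeps the head available for further use, and
-- `skip` discards it for good.
data Span {n} : Vec (Vec ℕ n) m → Pred (Vec ℕ n) 0ℓ where
  none : {C : Vec (Vec ℕ n) m} → Span C (replicate n 0)
  skip : ∀ {c x} {C : Vec (Vec ℕ n) m} → Span C x → Span (c ∷ C) x
  use  : ∀ {c x} {C : Vec (Vec ℕ n) m} → Span (c ∷ C) x → Span (c ∷ C) (c ⊕ x)

-- A backtracking search whose fuel bounds the number of subtractions; skipping costs none because
-- it shortens the list. Only a `just` carries information.
searchSpan : ℕ → (C : Vec (Vec ℕ n) m) → ∀ x → Maybe (Span C x)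
searchSpan fuel C x with ≡-dec _≟_ x (replicate _ 0)
searchSpan fuel       C       x | yes refl = just none
searchSpan fuel       []      x | no _     = nothing
searchSpan zero       (c ∷ C) x | no _     = Maybe.map skip (searchSpan zero C x)
searchSpan (suc fuel) (c ∷ C) x | no _     =
  Maybe.map skip (searchSpan (suc fuel) C x) <∣> subtract
  where
  subtract : Maybe (Span (c ∷ C) x)
  -- As subtraction is truncated, this equation holds exactly when `c` is at most `x` in every
  -- coordinate.
  subtract with ≡-dec _≟_ x (c ⊕ zipWith _∸_ x c)
  ... | yes eq = Maybe.map (λ s → subst (Span (c ∷ C)) (sym eq) (use s))
                           (searchSpan fuel (c ∷ C) (zipWith _∸_ x c))
  ... | no _   = nothing

-- Removing a nonzero vector lowers the sum of the entries by at least one, so `sum x` is enough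
-- fuel.
span? : (C : Vec (Vec ℕ n) m) → ∀ x → Maybe (Span C x)
span? C x = searchSpan (sum x) C x

allVec? : ∀ {p} n {P : Pred (Vec (Fin p) n) 0ℓ} → Decidable P → Dec (∀ r → P r)
allVec? zero    P? = map′ (λ { P[] [] → P[] }) (λ P → P []) (P? [])
allVec? (suc n) P? =
  map′ (λ { P (i ∷ r) → P i r }) (λ P i r → P (i ∷ r))
       (Fin.all? λ i → allVec? n λ r → P? (i ∷ r))

-- Linear forms are kept as syntax so that they evaluate definitionally to
-- expressions such as 2 * a₁ + a₂.
infixl 6 _:+_
infixl 7 _:*_

data Form (n : ℕ) : Set where
  var  : Fin n → Form n
  _:+_ : Form n → Form n → Form n
  _:*_ : ℕ → Form n → Form n

⟦_⟧ : Form n → Vec ℕ n → ℕ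
⟦ var i ⟧  a = lookup a i
⟦ f :+ g ⟧ a = ⟦ f ⟧ a + ⟦ g ⟧ a
⟦ s :* f ⟧ a = s * ⟦ f ⟧ a

coefficients : Form n → Vec ℕ n
coefficients (var i)  = unit i
coefficients (f :+ g) = coefficients f ⊕ coefficients g
coefficients (s :* f) = map (s *_) (coefficients f)

⟦⟧-coefficients : ∀ (f : Form n) a → coefficients f · a ≡ ⟦ f ⟧ a
⟦⟧-coefficients (var i)  a = ·-unit i a
⟦⟧-coefficients (f :+ g) a =
  trans (·-distribʳ-⊕ a (coefficients f) (coefficients g))
        (cong₂ _+_ (⟦⟧-coefficients f a) (⟦⟧-coefficients g a))
⟦⟧-coefficients (s :* f) a =
  trans (·-assoc-map s (coefficients f) a) (cong (s *_) (⟦⟧-coefficients f a))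

-- `whole` is separate from `divided` so that its value is an entry of `a` definitionally, not a
-- multiple of `p` divided by `p`.
data Generator (n : ℕ) : Set where
  whole   : Fin n → Generator n
  divided : Form n → Generator n

-- The quotient by p from a finite check on residues

module Quotient (p : ℕ) .{{_ : NonZero p}} where

  value : Vec ℕ n → Generator n → ℕ
  value a (whole i)   = lookup a i
  value a (divided f) = ⟦ f ⟧ a / p

  numerator : Generator n → Vec ℕ n
  numerator (whole i)   = map (p *_) (unit i)
  numerator (divided f) = coefficients f

  -- In turn: every generator is an exact quotient, every entry of `a` is generated, and so is every
  -- residue vector orthogonal to `t` modulo `p`. The second clause is not an instance of the third,
  -- since the entry `p` exceeds every residue.
  Admissible : Vec ℕ n → Vec (Generator n) m → Set
  Admissible {n} t gs =
    All (λ g → p ∣ numerator g · t) gs ×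
    (∀ i → T (is-just (span? C (map (p *_) (unit i))))) ×
    (∀ (r : Vec (Fin p) n) → p ∣ map toℕ r · t → T (is-just (span? C (map toℕ r))))
    where C = map numerator gs

  admissible? : (t : Vec ℕ n) (gs : Vec (Generator n) m) → Dec (Admissible t gs)
  admissible? {n} t gs =
    all? (λ g → p ∣? numerator g · t) gs ×-dec
    Fin.all? (λ _ → T? _) ×-dec
    allVec? n (λ r → (p ∣? map toℕ r · t) →-dec T? _)

  module _ (k t : Vec ℕ n) where

    private
      a : Vec ℕ n
      a = map (p *_) k ⊕ t

    ∣-· : ∀ x → p ∣ x · t → p ∣ x · a
    ∣-· x p∣ = subst (p ∣_) (sym (·-affine p x k t)) (∣m∣n⇒∣m+n (m∣m*n _) p∣)

    ∣-·⁻¹ : ∀ x → p ∣ x · a → p ∣ x · t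
    ∣-·⁻¹ x p∣ = ∣m+n∣m⇒∣n (subst (p ∣_) (·-affine p x k t) p∣) (m∣m*n (x · k))

    -- The rounding division in `value` is exact here, since divisibility at `t` transfers to `a`.
    p*value : ∀ g → p ∣ numerator g · t → p * value a g ≡ numerator g · a
    p*value (whole i)   _  = sym (·-scaled-unit p i a)
    p*value (divided f) p∣ =
      trans (m*[n/m]≡n (subst (p ∣_) eq (∣-· (coefficients f) p∣))) (sym eq)
      where eq = ⟦⟧-coefficients f a

    values-∈-÷ : {gs : Vec (Generator n) m} → All (λ g → p ∣ numerator g · t) gs →
                 All (_∈ ⟨ a ⟩ ÷ p) (map (value a) gs)
    values-∈-÷ p∣s = map⁺ (All.map (λ {g} p∣ → numerator g , p*value g p∣) p∣s)

    -- Replays a decomposition of numerators on the generators themselves: `skip` prepends the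
    -- coefficient 0, and `use` raises the leading coefficient by one.
    span-∈ : (gs : Vec (Generator n) m) → All (λ g → p ∣ numerator g · t) gs →
             ∀ {x} → Span (map numerator gs) x →
             ∃[ v ] v ∈ ⟨ map (value a) gs ⟩ × p * v ≡ x · a
    span-∈ []       _ none = 0 , 0∈⟨⟩ [] , trans (*-zeroʳ p) (sym (·-zeroˡ a))
    span-∈ (g ∷ gs) _ none = 0 , 0∈⟨⟩ _ , trans (*-zeroʳ p) (sym (·-zeroˡ a))
    span-∈ (g ∷ gs) (_ ∷ p∣s) (skip s) with span-∈ gs p∣s s
    ... | v , (y , v≡) , pv≡ = v , (0 ∷ y , v≡) , pv≡
    span-∈ (g ∷ gs) (p∣ ∷ p∣s) (use {x = x} s) with span-∈ (g ∷ gs) (p∣ ∷ p∣s) s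
    ... | v , (y ∷ ys , v≡) , pv≡ =
      value a g + v ,
      (suc y ∷ ys , trans (cong (value a g +_) v≡) (sym (+-assoc (value a g) _ _))) ,
      (begin
        p * (value a g + v)       ≡⟨ *-distribˡ-+ p (value a g) v ⟩
        p * value a g + p * v     ≡⟨ cong₂ _+_ (p*value g p∣) pv≡ ⟩
        numerator g · a + x · a   ≡⟨ ·-distribʳ-⊕ a (numerator g) x ⟨
        (numerator g ⊕ x) · a     ∎)
      where open ≡-Reasoning

    -- For concrete `p`, `t` and `gs` the implicit argument is found by evaluation, while `k` stays
    -- arbitrary.
    quotient-⟨⟩ : (gs : Vec (Generator n) m) {_ : True (admissible? t gs)} →
                  ⟨ a ⟩ ÷ p ≐ ⟨ map (value a) gs ⟩
    quotient-⟨⟩ gs {check} = forward , backward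
      where
      open ≡-Reasoning
      b = map (value a) gs
      C = map numerator gs
      adm = toWitness check
      exact = proj₁ adm

      -- The element built from the decomposition has the same multiple by `p` as `v`, so cancelling
      -- `p` identifies the two.
      ∈-via : ∀ {v x} → p * v ≡ x · a → Span C x → v ∈ ⟨ b ⟩
      ∈-via pv≡ s with span-∈ gs exact s
      ... | w , w∈ , pw≡ =
        subst (_∈ ⟨ b ⟩) (*-cancelˡ-≡ w _ p (trans pw≡ (sym pv≡))) w∈

      a∈ : ∀ i → lookup a i ∈ ⟨ b ⟩
      a∈ i = ∈-via {lookup a i} {map (p *_) (unit i)}
        (sym (·-scaled-unit p i a)) (to-witness-T _ (proj₁ (proj₂ adm) i))

      forward : ⟨ a ⟩ ÷ p ⊆ ⟨ b ⟩
      forward {v} (x , pv≡) with ∃-divMod p x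
      ... | q , r , refl = subst (_∈ ⟨ b ⟩) (sym v≡) (⟨⟩-closed-+ b q·a∈ w∈)
        where
        pv≡′ : p * v ≡ p * (q · a) + map toℕ r · a
        pv≡′ = trans pv≡ (trans (·-distribʳ-⊕ a (map (p *_) q) (map toℕ r))
                                (cong (_+ map toℕ r · a) (·-assoc-map p q a)))

        -- `p` divides both `p * v` and `p * (q · a)`, hence `r · a`, and therefore `r · t`.
        p∣r : p ∣ map toℕ r · t
        p∣r = ∣-·⁻¹ (map toℕ r) (∣m+n∣m⇒∣n (subst (p ∣_) pv≡′ (m∣m*n v)) (m∣m*n (q · a)))

        rest = span-∈ gs exact (to-witness-T _ (proj₂ (proj₂ adm) r p∣r))
        w = proj₁ rest
        w∈ = proj₁ (proj₂ rest)

        q·a∈ : q · a ∈ ⟨ b ⟩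
        q·a∈ = ⟨⟩-least {P = ⟨ b ⟩} (0∈⟨⟩ b) (λ {u} {v} → ⟨⟩-closed-+ b {u} {v})
                        (lookup⁻ {xs = a} a∈) {q · a} (q , refl)

        v≡ : v ≡ q · a + w
        v≡ = *-cancelˡ-≡ v _ p (begin
          p * v                          ≡⟨ pv≡′ ⟩
          p * (q · a) + map toℕ r · a    ≡⟨ cong (p * (q · a) +_) (proj₂ (proj₂ rest)) ⟨
          p * (q · a) + p * w            ≡⟨ *-distribˡ-+ p (q · a) w ⟨
          p * (q · a + w)                ∎)

      backward : ⟨ b ⟩ ⊆ ⟨ a ⟩ ÷ p
      -- The quotient is itself a submonoid, so containing the generators suffices.
      backward = ⟨⟩-least (subst (_∈ ⟨ a ⟩) (sym (*-zeroʳ p)) (0∈⟨⟩ a))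
                          (λ {u} {v} → ÷-closed-+ p a {u} {v}) (values-∈-÷ exact)

-- The residue cases for p = 2 and p = 3

open Quotient using (quotient-⟨⟩)

mainTheorem2 :
  ∀ (p a₁ a₂ a₃ k₁ k₂ k₃ t₁ t₂ t₃ : ℕ) →
  (p ≡ 2 ⊎ p ≡ 3) →
  gcd a₁ (gcd a₂ a₃) ≡ 1 →
  1 ≤ k₁ → 1 ≤ k₂ → 1 ≤ k₃ →
  t₁ ≤ p ∸ 1 → t₂ ≤ p ∸ 1 → t₃ ≤ p ∸ 1 →
  a₁ ≡ p * k₁ + t₁ → a₂ ≡ p * k₂ + t₂ → a₃ ≡ p * k₃ + t₃ →
  let A = a₁ ∷ a₂ ∷ a₃ ∷ []
      t = (t₁ , t₂ , t₃)
  in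
  (p ≡ 2 →
    (t ≡ (0 , 0 , 1) →
      ⟨ A ⟩ ÷ 2 ≐ ⟨ a₁ / 2 ∷ a₂ / 2 ∷ a₃ ∷ [] ⟩)
    ×
    (t ≡ (0 , 1 , 1) →
      ⟨ A ⟩ ÷ 2 ≐ ⟨ a₁ / 2 ∷ a₂ ∷ a₃ ∷ (a₂ + a₃) / 2 ∷ [] ⟩)
    ×
    (t ≡ (1 , 1 , 1) →
      ⟨ A ⟩ ÷ 2 ≐
        ⟨ a₁ ∷ a₂ ∷ a₃
        ∷ (a₁ + a₂) / 2 ∷ (a₁ + a₃) / 2 ∷ (a₂ + a₃) / 2 ∷ [] ⟩))
  ×
  (p ≡ 3 →
    (t ≡ (0 , 0 , 1) ⊎ t ≡ (0 , 0 , 2) →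
      ⟨ A ⟩ ÷ 3 ≐ ⟨ a₁ / 3 ∷ a₂ / 3 ∷ a₃ ∷ [] ⟩)
    ×
    (t ≡ (0 , 1 , 1) ⊎ t ≡ (0 , 2 , 2) →
      ⟨ A ⟩ ÷ 3 ≐
        ⟨ a₁ / 3 ∷ a₂ ∷ a₃
        ∷ (2 * a₂ + a₃) / 3 ∷ (a₂ + 2 * a₃) / 3 ∷ [] ⟩)
    ×
    (t ≡ (0 , 1 , 2) →
      ⟨ A ⟩ ÷ 3 ≐ ⟨ a₁ / 3 ∷ a₂ ∷ a₃ ∷ (a₂ + a₃) / 3 ∷ [] ⟩)
    ×
    (t ≡ (1 , 1 , 1) ⊎ t ≡ (2 , 2 , 2) →
      ⟨ A ⟩ ÷ 3 ≐
        ⟨ a₁ ∷ a₂ ∷ a₃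
        ∷ (2 * a₁ + a₂) / 3 ∷ (2 * a₁ + a₃) / 3
        ∷ (2 * a₂ + a₁) / 3 ∷ (2 * a₂ + a₃) / 3
        ∷ (2 * a₃ + a₁) / 3 ∷ (2 * a₃ + a₂) / 3
        ∷ (a₁ + a₂ + a₃) / 3 ∷ [] ⟩)
    ×
    (t ≡ (1 , 1 , 2) →
      ⟨ A ⟩ ÷ 3 ≐
        ⟨ a₁ ∷ a₂ ∷ a₃
        ∷ (a₁ + a₃) / 3 ∷ (a₂ + a₃) / 3
        ∷ (2 * a₁ + a₂) / 3 ∷ (2 * a₂ + a₁) / 3 ∷ [] ⟩)
    ×
    (t ≡ (1 , 2 , 2) →
      ⟨ A ⟩ ÷ 3 ≐
        ⟨ a₁ ∷ a₂ ∷ a₃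
        ∷ (a₁ + a₂) / 3 ∷ (a₁ + a₃) / 3
        ∷ (2 * a₂ + a₃) / 3 ∷ (2 * a₃ + a₂) / 3 ∷ [] ⟩))
-- Matching the last three equations turns each entry of `A` into `p * kᵢ + tᵢ`, so `A` is
-- definitionally `map (p *_) k ⊕ t`.
mainTheorem2 _ _ _ _ k₁ k₂ k₃ _ _ _ _ _ _ _ _ _ _ _ refl refl refl =
  (λ { refl →
    (λ { refl → quotient-⟨⟩ 2 k (0 ∷ 0 ∷ 1 ∷ [])
      (divided x₁ ∷ divided x₂ ∷ a₃ ∷ []) }) ,
    (λ { refl → quotient-⟨⟩ 2 k (0 ∷ 1 ∷ 1 ∷ [])
      (divided x₁ ∷ a₂ ∷ a₃ ∷ divided (x₂ :+ x₃) ∷ []) }) ,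
    (λ { refl → quotient-⟨⟩ 2 k (1 ∷ 1 ∷ 1 ∷ [])
      (a₁ ∷ a₂ ∷ a₃
      ∷ divided (x₁ :+ x₂) ∷ divided (x₁ :+ x₃) ∷ divided (x₂ :+ x₃) ∷ []) }) }) ,
  (λ { refl →
    -- The paired residue vectors differ by the factor 2, a unit modulo 3. They are orthogonal to
    -- the same vectors, so one list of generators serves both.
    (λ { (inj₁ refl) → quotient-⟨⟩ 3 k (0 ∷ 0 ∷ 1 ∷ []) gens001
       ; (inj₂ refl) → quotient-⟨⟩ 3 k (0 ∷ 0 ∷ 2 ∷ []) gens001 }) ,
    (λ { (inj₁ refl) → quotient-⟨⟩ 3 k (0 ∷ 1 ∷ 1 ∷ []) gens011
       ; (inj₂ refl) → quotient-⟨⟩ 3 k (0 ∷ 2 ∷ 2 ∷ []) gens011 }) ,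
    (λ { refl → quotient-⟨⟩ 3 k (0 ∷ 1 ∷ 2 ∷ [])
      (divided x₁ ∷ a₂ ∷ a₃ ∷ divided (x₂ :+ x₃) ∷ []) }) ,
    (λ { (inj₁ refl) → quotient-⟨⟩ 3 k (1 ∷ 1 ∷ 1 ∷ []) gens111
       ; (inj₂ refl) → quotient-⟨⟩ 3 k (2 ∷ 2 ∷ 2 ∷ []) gens111 }) ,
    (λ { refl → quotient-⟨⟩ 3 k (1 ∷ 1 ∷ 2 ∷ [])
      (a₁ ∷ a₂ ∷ a₃
      ∷ divided (x₁ :+ x₃) ∷ divided (x₂ :+ x₃)
      ∷ divided (2 :* x₁ :+ x₂) ∷ divided (2 :* x₂ :+ x₁) ∷ []) }) ,
    (λ { refl → quotient-⟨⟩ 3 k (1 ∷ 2 ∷ 2 ∷ [])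
      (a₁ ∷ a₂ ∷ a₃
      ∷ divided (x₁ :+ x₂) ∷ divided (x₁ :+ x₃)
      ∷ divided (2 :* x₂ :+ x₃) ∷ divided (2 :* x₃ :+ x₂) ∷ []) }) })
  where
  k : Vec ℕ 3
  k = k₁ ∷ k₂ ∷ k₃ ∷ []

  x₁ x₂ x₃ : Form 3
  x₁ = var zero
  x₂ = var (suc zero)
  x₃ = var (suc (suc zero))

  a₁ a₂ a₃ : Generator 3
  a₁ = whole zero
  a₂ = whole (suc zero)
  a₃ = whole (suc (suc zero))

  gens001 : Vec (Generator 3) 3
  gens001 = divided x₁ ∷ divided x₂ ∷ a₃ ∷ []

  gens011 : Vec (Generator 3) 5
  gens011 = divided x₁ ∷ a₂ ∷ a₃ ∷ divided (2 :* x₂ :+ x₃) ∷ divided (x₂ :+ 2 :* x₃) ∷ []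

  gens111 : Vec (Generator 3) 10
  gens111 =
    a₁ ∷ a₂ ∷ a₃
    ∷ divided (2 :* x₁ :+ x₂) ∷ divided (2 :* x₁ :+ x₃)
    ∷ divided (2 :* x₂ :+ x₁) ∷ divided (2 :* x₂ :+ x₃)
    ∷ divided (2 :* x₃ :+ x₁) ∷ divided (2 :* x₃ :+ x₂)
    ∷ divided (x₁ :+ x₂ :+ x₃) ∷ []
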